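{- The following two statements are equivalent: (a) (WHC) holds for all hypergraphs, i.e. for every hypergraph $H=(V,E)$ with $V\neq\varnothing\neq E$ and every cardinal $\kappa\neq\varnothing$: if for every map $c:V\to\kappa$ there is $e\in E$ with $|e|\geq 2$ such that $c|_e:e\to\kappa$ is constant, then there is ${\mathcal S}\subseteq{\mathcal P}(V)$ such that (1) $|{\mathcal S}|=\kappa$, (2) every member of ${\mathcal S}$ is connected in $H$, and (3) whenever $T_0,T_1\in{\mathcal S}$ with $T_0\neq T_1$, then $T_0,T_1$ are disjoint and connected to each other in $H$. (b) (WHC) holds for all graphs, i.e. the assertion in (a) holds for every cardinal $\kappa\neq\varnothing$ and every hypergraph $H=(V,E)$ with $V\neq\varnothing\neq E$ in which every edge $e\in E$ has size exactly $2$.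
   Context: A hypergraph $H=(V,E)$ consists of a set $V$ (possibly infinite) and a set $E\subseteq{\mathcal P}(V)$ of subsets of $V$ of arbitrary size, called edges. A graph is a hypergraph in which every edge has size $2$. Cardinals may be finite or infinite; a cardinal $\kappa$ is regarded as a set of cardinality $\kappa$, and $\kappa\neq\varnothing$ means that $\kappa$ is nonzero. A subset $S\subseteq V$ is connected in $H$ if for every nonempty $X\subseteq S$ with $X\neq S$ there is $e\in E$ such that $(e\cap S)\cap X\neq\varnothing$ and $(e\cap S)\setminus X\neq\varnothing$. Two disjoint subsets $S_1,S_2\subseteq V$ are connected to each other in $H$ if there is $e\in E$ such that $e\cap S_1\neq\varnothing$ and $e\cap S_2\neq\varnothing$. -}

module Defs where

open import Level using (Level; suc)
open import Data.Fin.Base using (Fin)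
open import Data.Product.Base using (Σ; ∃; _×_; proj₁)
open import Function.Bundles using (Injection; Bijection)
open import Relation.Binary.Bundles using (Setoid)
open import Relation.Binary.Definitions using (_Respects_)
open import Relation.Binary.PropositionalEquality.Core using (_≡_)
import Relation.Binary.Construct.On as On
import Relation.Binary.PropositionalEquality.Properties as ≡
open import Relation.Nullary.Negation.Core using (¬_)
open import Relation.Unary
  using (Pred; _∈_; _⊆_; _≐_; _∩_; _∖_; _≬_; _⊥_; Satisfiable)
open import Relation.Unary.Relation.Binary.Equality using (≐-setoid)

-- The types in Set ℓ play the role of the sets.  Subsets of V are predicates,
-- and two subsets are equal when they have the same members (_≐_).  A set of
-- subsets is therefore a predicate on Pred V ℓ that respects _≐_; it lives in
-- Set (suc ℓ) so that it may be defined by quantifying over subsets of V.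
-- Nonemptiness is always the existence of an element.

record Hypergraph (ℓ : Level) : Set (suc (suc ℓ)) where
  field
    V         : Set ℓ
    Edge      : Pred (Pred V ℓ) (suc ℓ)
    Edge-resp : Edge Respects _≐_

-- The elements of A satisfying P, as a set in its own right: the equality is
-- that of A, so different proofs of P x do not give different members.
Members : ∀ {a ℓ p} (A : Setoid a ℓ) → Pred (Setoid.Carrier A) p → Setoid _ _
Members A P = On.setoid A (proj₁ {A = Setoid.Carrier A} {B = P})

HasCardinality : ∀ {a ℓ k} → Setoid a ℓ → Set k → Set _
HasCardinality A κ = Bijection (≡.setoid κ) A

HasCardinalityAtLeast : ∀ {a ℓ k} → Setoid a ℓ → Set k → Set _
HasCardinalityAtLeast A κ = Injection (≡.setoid κ) A

ConstantOn : ∀ {a p k} {A : Set a} {κ : Set k} → (A → κ) → Pred A p → Set _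
ConstantOn c e = ∀ x y → x ∈ e → y ∈ e → c x ≡ c y

module _ {ℓ : Level} (H : Hypergraph ℓ) where
  open Hypergraph H

  IsGraph : Set (suc ℓ)
  IsGraph = ∀ e → e ∈ Edge → HasCardinality (Members (≡.setoid V) e) (Fin 2)

  Connected : Pred V ℓ → Set (suc ℓ)
  Connected S = ∀ (X : Pred V ℓ) → Satisfiable X → X ⊆ S → ¬ (X ≐ S) →
    ∃ λ e → e ∈ Edge × Satisfiable ((e ∩ S) ∩ X) × Satisfiable ((e ∩ S) ∖ X)

  ConnectedToEachOther : Pred V ℓ → Pred V ℓ → Set (suc ℓ)
  ConnectedToEachOther S₁ S₂ = ∃ λ e → e ∈ Edge × e ≬ S₁ × e ≬ S₂

  -- The assertion of (WHC) for H and the cardinality of κ; V, κ and Edge are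
  -- assumed nonempty where it is used.
  WHC : Set ℓ → Set (suc (suc ℓ))
  WHC κ =
    (∀ (c : V → κ) → ∃ λ e →
       e ∈ Edge
       × HasCardinalityAtLeast (Members (≡.setoid V) e) (Fin 2)
       × ConstantOn c e) →
    Σ (Pred (Pred V ℓ) (suc ℓ)) λ 𝒮 →
      𝒮 Respects _≐_
      × HasCardinality (Members (≐-setoid V ℓ) 𝒮) κ
      × (∀ T → T ∈ 𝒮 → Connected T)
      × (∀ T₀ T₁ → T₀ ∈ 𝒮 → T₁ ∈ 𝒮 → ¬ (T₀ ≐ T₁) →
           T₀ ⊥ T₁ × ConnectedToEachOther T₀ T₁)

{-# OPTIONS --safe #-}
-- Replace every hyperedge by the complete graph on its vertices.  A hyperedge
-- with two distinct vertices is monochromatic only if each of its pairs is, so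
-- the graph inherits the colouring hypothesis.  Conversely every pair lies in a
-- hyperedge, which meets whatever the pair meets, so a family that witnesses
-- (WHC) for the graph witnesses it for the hypergraph.
module Submission where

open import Defs
open import Level using (Level)
open import Data.Fin.Base using (Fin; zero; suc)
open import Data.Product.Base using (∃; ∃₂; _×_; _,_; proj₁)
open import Data.Sum.Base using (inj₁; inj₂; [_,_])
open import Function.Base using (_∘_; case_of_; id)
open import Function.Bundles using (_⇔_; mk⇔; module Bijection; module Injection)
open import Relation.Binary.PropositionalEquality
  using (_≡_; _≢_; refl; sym; setoid)
open import Relation.Nullary.Negation.Core using (contradiction)
open import Relation.Unary
  using (Pred; _∈_; _⊆_; _≐_; _∪_; ｛_｝; Satisfiable)
open import Relation.Unary.Properties using (≐-sym; ≐-trans)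
open Hypergraph using (V; Edge)

module _ {a} {A : Set a} where

  pair-⊆ : ∀ {p} {P : Pred A p} {x y} → x ∈ P → y ∈ P → (｛ x ｝ ∪ ｛ y ｝) ⊆ P
  pair-⊆ x∈P y∈P = [ (λ { refl → x∈P }) , (λ { refl → y∈P }) ]

  -- Takes `P` only up to `≐`, since edge sets are closed under `≐` and an edge need not be
  -- literally a union of two singletons.
  pair-cardinality : ∀ {p} {P : Pred A p} {x y} → x ≢ y → P ≐ ｛ x ｝ ∪ ｛ y ｝ →
                     HasCardinality (Members (setoid A) P) (Fin 2)
  pair-cardinality {P = P} {x} {y} x≢y (P⊆xy , xy⊆P) = record
    { to        = to
    ; cong      = λ { refl → refl }
    ; bijective = injective _ _ , surjective
    }
    where
    to : Fin 2 → ∃ P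
    to zero    = x , xy⊆P (inj₁ refl)
    to (suc _) = y , xy⊆P (inj₂ refl)

    injective : ∀ i j → proj₁ (to i) ≡ proj₁ (to j) → i ≡ j
    injective zero       zero       _   = refl
    injective zero       (suc zero) x≡y = contradiction x≡y x≢y
    injective (suc zero) zero       y≡x = contradiction (sym y≡x) x≢y
    injective (suc zero) (suc zero) _   = refl

    surjective : ∀ (z : ∃ P) → ∃ λ i → ∀ {j} → j ≡ i → proj₁ (to j) ≡ proj₁ z
    surjective (z , z∈P) with P⊆xy z∈P
    ... | inj₁ x≡z = zero     , λ { refl → x≡z }
    ... | inj₂ y≡z = suc zero , λ { refl → y≡z }

  distinct-members : ∀ {p} {P : Pred A p} →
                     HasCardinalityAtLeast (Members (setoid A) P) (Fin 2) →
                     ∃₂ λ x y → x ∈ P × y ∈ P × x ≢ y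
  distinct-members f =
    let x , x∈P = to zero
        y , y∈P = to (suc zero)
    in x , y , x∈P , y∈P , λ x≡y → case injective x≡y of λ ()
    where open Injection f

module _ {ℓ : Level} (H : Hypergraph ℓ) where

  -- The condition `x ≢ y` rules out loops, so a hyperedge with at most one vertex yields no pair.
  -- Comparing `d` by `≐` makes the predicate respect `≐`.
  CliqueEdge : Pred (Pred (V H) ℓ) _
  CliqueEdge d = ∃ λ e → e ∈ Edge H ×
    ∃₂ λ x y → x ∈ e × y ∈ e × x ≢ y × d ≐ ｛ x ｝ ∪ ｛ y ｝

  cliqueGraph : Hypergraph ℓ
  cliqueGraph = record
    { V         = V H
    ; Edge      = CliqueEdge
    ; Edge-resp = λ { d≐d′ (e , e∈E , x , y , x∈e , y∈e , x≢y , d≐xy) →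
        e , e∈E , x , y , x∈e , y∈e , x≢y , ≐-trans (≐-sym d≐d′) d≐xy }
    }

  cliqueGraph-isGraph : IsGraph cliqueGraph
  cliqueGraph-isGraph d (_ , _ , _ , _ , _ , _ , x≢y , d≐xy) =
    pair-cardinality x≢y d≐xy

  -- Lets a hyperedge replace a clique edge as a witness: whatever `d` meets, `e` meets too.
  cliqueEdge-⊆ : ∀ {d} → d ∈ CliqueEdge → ∃ λ e → e ∈ Edge H × d ⊆ e
  cliqueEdge-⊆ (e , e∈E , _ , _ , x∈e , y∈e , _ , d⊆xy , _) =
    e , e∈E , pair-⊆ x∈e y∈e ∘ d⊆xy

  -- Both graphs test the same sets `X`, and enlarging the crossing pair to a hyperedge keeps its
  -- points `u` in `X` and `v` outside `X`.
  connected⁻ : ∀ {S} → Connected cliqueGraph S → Connected H S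
  connected⁻ conn X X≠∅ X⊆S X≠S with conn X X≠∅ X⊆S X≠S
  ... | d , d∈E , (u , (u∈d , u∈S) , u∈X) , (v , (v∈d , v∈S) , v∉X)
      with cliqueEdge-⊆ d∈E
  ... | e , e∈E , d⊆e =
    e , e∈E , (u , (d⊆e u∈d , u∈S) , u∈X) , (v , (d⊆e v∈d , v∈S) , v∉X)

  connectedToEachOther⁻ : ∀ {S T} → ConnectedToEachOther cliqueGraph S T →
                          ConnectedToEachOther H S T
  connectedToEachOther⁻ (d , d∈E , (u , u∈d , u∈S) , (v , v∈d , v∈T))
    with cliqueEdge-⊆ d∈E
  ... | e , e∈E , d⊆e = e , e∈E , (u , d⊆e u∈d , u∈S) , (v , d⊆e v∈d , v∈T)

  -- The premise of `WHC`, isolated so that it can be carried over to the clique graph.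
  NoProperColouring : Set ℓ → Set _
  NoProperColouring κ = ∀ (c : V H → κ) → ∃ λ e →
    e ∈ Edge H
    × HasCardinalityAtLeast (Members (setoid (V H)) e) (Fin 2)
    × ConstantOn c e

module _ {ℓ : Level} (H : Hypergraph ℓ) where

  noProperColouring⁺ : ∀ {κ} → NoProperColouring H κ →
                       NoProperColouring (cliqueGraph H) κ
  noProperColouring⁺ mono c with mono c
  ... | e , e∈E , ∣e∣≥2 , const with distinct-members ∣e∣≥2
  ... | x , y , x∈e , y∈e , x≢y =
    -- Any two distinct points of `e` will do, as constancy of `c` restricts from `e` to the pair.
    (｛ x ｝ ∪ ｛ y ｝)
    , (e , e∈E , x , y , x∈e , y∈e , x≢y , id , id)
    , Bijection.injection (pair-cardinality x≢y (id , id))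
    , λ u v u∈xy v∈xy → const u v (pair-⊆ x∈e y∈e u∈xy) (pair-⊆ x∈e y∈e v∈xy)

  -- An edge of `H` may have fewer than two vertices, so a clique edge has to come from the
  -- colouring premise instead.
  WHC⁻ : ∀ {κ} → (Satisfiable (CliqueEdge H) → WHC (cliqueGraph H) κ) → κ → WHC H κ
  WHC⁻ whc k mono with noProperColouring⁺ mono
  ... | mono′ with mono′ (λ _ → k)
  -- The constant colouring with value `k` already forces a clique edge `d`.
  ... | d , d∈E , _ with whc (d , d∈E) mono′
  ... | 𝒮 , resp , card , conn , linked =
    -- The vertex set is unchanged, so the same family works; its size and disjointness do not
    -- depend on the edges.
    𝒮 , resp , card
    , (λ T T∈𝒮 → connected⁻ H (conn T T∈𝒮))
    , λ T₀ T₁ T₀∈𝒮 T₁∈𝒮 T₀≠T₁ →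
        let disjoint , link = linked T₀ T₁ T₀∈𝒮 T₁∈𝒮 T₀≠T₁
        in disjoint , connectedToEachOther⁻ H link

proposition3p1 : ∀ (ℓ : Level) →
    (∀ (H : Hypergraph ℓ) → V H → Satisfiable (Edge H) →
    ∀ (κ : Set ℓ) → κ → WHC H κ)
    ⇔
    (∀ (H : Hypergraph ℓ) → IsGraph H → V H → Satisfiable (Edge H) →
    ∀ (κ : Set ℓ) → κ → WHC H κ)
proposition3p1 ℓ = mk⇔
  (λ whc H _ → whc H)
  (λ whc H v _ κ k → WHC⁻ H (λ E≠∅ → whc (cliqueGraph H) (cliqueGraph-isGraph H) v E≠∅ κ k) k)
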